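{- $t(K(8,3)) =\frac{5}{3}$. Moreover, if $S$ is a vertex cut of $K(8,3)$ such that $\frac{|S|}{c(K(8,3)\setminus S)} = \frac{5}{3}$, then $S$ is the complement of a maximum independent set of $K(8,3)$.
   Context: The Kneser graph $K(n,k)$ has as vertices the $k$-element subsets of $[n]=\{1,\dots,n\}$, two vertices adjacent iff the subsets are disjoint. A vertex cut is a set $S$ of vertices whose removal disconnects the graph; $c(G\setminus S)$ is the number of connected components after deleting $S$; the toughness is $t(G)=\min_S |S|/c(G\setminus S)$ over all vertex cuts $S$. -}

module Defs where

open import Data.Nat using (ℕ; _≤_)
open import Data.Fin using (Fin)
open import Data.Fin.Subset using (Subset; ∣_∣; _∩_; ⊥)
open import Data.List using (List; length)
open import Data.List.Membership.Propositional using (_∈_; _∉_)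
open import Data.List.Relation.Unary.All using (All)
open import Data.List.Relation.Unary.Unique.Propositional using (Unique)
open import Data.Product using (Σ; ∃; ∃-syntax; _×_)
open import Relation.Binary.PropositionalEquality using (_≡_)
open import Relation.Nullary using (¬_)
open import Function.Bundles using (_⇔_)

module Kneser (n k : ℕ) where

  IsVertex : Subset n → Set
  IsVertex A = ∣ A ∣ ≡ k

  Adj : Subset n → Subset n → Set
  Adj A B = A ∩ B ≡ ⊥

  record VertexSet : Set where
    constructor vset
    field
      elems    : List (Subset n)
      vertices : All IsVertex elems
      unique   : Unique elems

  open VertexSet public

  size : VertexSet → ℕ
  size S = length (elems S)

  Alive : VertexSet → Subset n → Set
  Alive S A = IsVertex A × A ∉ elems S

  data Reach (S : VertexSet) : Subset n → Subset n → Set where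
    here : ∀ {u} → Alive S u → Reach S u u
    step : ∀ {u v w} → Alive S u → Adj u v → Reach S v w → Reach S u w

  IsVertexCut : VertexSet → Set
  IsVertexCut S = ∃[ u ] ∃[ v ] (Alive S u × Alive S v × ¬ Reach S u v)

  -- c(G \ S) = c : there is a system of representatives of the connected
  -- components of G \ S indexed by Fin c (one vertex per component).
  NumComponents : VertexSet → ℕ → Set
  NumComponents S c =
    Σ (Fin c → Subset n) λ r →
      (∀ i → Alive S (r i)) ×
      (∀ i j → Reach S (r i) (r j) → i ≡ j) ×
      (∀ v → Alive S v → ∃[ i ] Reach S (r i) v)

  IsIndependent : VertexSet → Set
  IsIndependent I = ∀ {A B} → A ∈ elems I → B ∈ elems I → ¬ Adj A B

  IsMaxIndependent : VertexSet → Set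
  IsMaxIndependent I = IsIndependent I × (∀ J → IsIndependent J → size J ≤ size I)

  IsComplementOf : VertexSet → VertexSet → Set
  IsComplementOf S I = ∀ A → IsVertex A → (A ∈ elems S ⇔ A ∉ elems I)

{-# OPTIONS --safe #-}
module Submission where

-- Let f be 2 on the isolated vertices of G \ S, 1 on the other surviving
-- vertices and 0 on S. The least eigenvalue of the adjacency matrix A gives the
-- Hoffman-type inequality 7 (fᵀAf + 6 |f|²) ≥ 2 (∑ f)², and (∑ f - 42)² ≥ 0
-- linearises it to fᵀAf + 6 |f|² + 504 ≥ 24 ∑ f. Both sides split over
-- components. A component with a vertices and e ordered adjacent pairs
-- contributes at least 9a + 15 to 24 ∑ f - fᵀAf - 6 |f|², with equality only
-- for a = 1: the eigenvalue 3 gives 8e ≤ 24a + a², which suffices for 3 ≤ a ≤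
-- 45, the case a ≤ 2 follows from e ≤ a² - a, and a ≤ 45 because a vertex of
-- another component and its ten neighbours are missed. Summing, 9 (56 - |S|) +
-- 15c ≤ 504, that is 5c ≤ 3|S|. In the case of equality all components are
-- singletons, so the survivors are independent, and there are 21 of them, which
-- is the Hoffman bound for independent sets. Both eigenvalue bounds are
-- certified by writing the matrices as sums of squares, up to scaling.

open import Defs
open import Data.List using (List)
open import Data.Nat using (ℕ)

-- Finite sums of integers over lists.

module Sums where

  open import Data.Integer using (ℤ; +_; 0ℤ; _+_; _*_; _≤_)
  open import Data.Integer.Properties
  open import Data.Integer.Tactic.RingSolver using (solve-∀)
  open import Data.List using (List; []; _∷_)
  open import Data.List.Membership.Propositional using (_∈_)
  open import Data.List.Relation.Unary.All as All using (_∷_)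
  open import Data.List.Relation.Unary.AllPairs using (_∷_)
  open import Data.List.Relation.Unary.Any using (here; there)
  open import Data.List.Relation.Unary.Unique.Propositional using (Unique)
  open import Function using (_∘_)
  open import Relation.Binary.PropositionalEquality
  open ≡-Reasoning

  ∑ : {A : Set} → List A → (A → ℤ) → ℤ
  ∑ []       f = 0ℤ
  ∑ (x ∷ xs) f = f x + ∑ xs f

  private variable
    A B : Set

  ∑-cong : ∀ (xs : List A) {f g} → (∀ {x} → x ∈ xs → f x ≡ g x) → ∑ xs f ≡ ∑ xs g
  ∑-cong []       e = refl
  ∑-cong (x ∷ xs) e = cong₂ _+_ (e (here refl)) (∑-cong xs (e ∘ there))

  ∑-0 : ∀ (xs : List A) → ∑ xs (λ _ → 0ℤ) ≡ 0ℤ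
  ∑-0 []       = refl
  ∑-0 (x ∷ xs) = trans (+-identityˡ _) (∑-0 xs)

  ∑-+ : ∀ (xs : List A) {f g} → ∑ xs (λ x → f x + g x) ≡ ∑ xs f + ∑ xs g
  ∑-+ []               = refl
  ∑-+ (x ∷ xs) {f} {g} = trans (cong (λ s → f x + g x + s) (∑-+ xs)) (interchange (f x) (g x) _ _)
    where
    interchange : ∀ a b c d → a + b + (c + d) ≡ a + c + (b + d)
    interchange = solve-∀

  ∑-*ˡ : ∀ k (xs : List A) {f} → ∑ xs (λ x → k * f x) ≡ k * ∑ xs f
  ∑-*ˡ k []           = sym (*-zeroʳ k)
  ∑-*ˡ k (x ∷ xs) {f} = trans (cong (λ s → k * f x + s) (∑-*ˡ k xs)) (sym (*-distribˡ-+ k (f x) _))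

  ∑-*ʳ : ∀ k (xs : List A) {f} → ∑ xs (λ x → f x * k) ≡ ∑ xs f * k
  ∑-*ʳ k xs {f} =
    trans (∑-cong xs (λ {x} _ → *-comm (f x) k)) (trans (∑-*ˡ k xs) (*-comm k _))

  ∑-swap : ∀ (xs : List A) (ys : List B) {f : A → B → ℤ} →
           ∑ xs (λ x → ∑ ys (f x)) ≡ ∑ ys (λ y → ∑ xs (λ x → f x y))
  ∑-swap []       ys     = sym (∑-0 ys)
  ∑-swap (x ∷ xs) ys {f} = trans (cong (λ s → ∑ ys (f x) + s) (∑-swap xs ys)) (sym (∑-+ ys))

  ∑-* : ∀ (xs : List A) (ys : List B) {f g} →
        ∑ xs f * ∑ ys g ≡ ∑ xs (λ x → ∑ ys (λ y → f x * g y))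
  ∑-* xs ys {f} = trans (sym (∑-*ʳ _ xs)) (∑-cong xs (λ {x} _ → sym (∑-*ˡ (f x) ys)))

  ∑-mono : ∀ (xs : List A) {f g} → (∀ {x} → x ∈ xs → f x ≤ g x) → ∑ xs f ≤ ∑ xs g
  ∑-mono []       le = ≤-refl
  ∑-mono (x ∷ xs) le = +-mono-≤ (le (here refl)) (∑-mono xs (le ∘ there))

  ∑-nonneg : ∀ (xs : List A) {f} → (∀ {x} → x ∈ xs → 0ℤ ≤ f x) → 0ℤ ≤ ∑ xs f
  ∑-nonneg xs {f} pos = subst (_≤ ∑ xs f) (∑-0 xs) (∑-mono xs pos)

  term≤∑ : ∀ {xs : List A} {f x} → (∀ {y} → y ∈ xs → 0ℤ ≤ f y) → x ∈ xs → f x ≤ ∑ xs f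
  term≤∑ {xs = x ∷ xs} {f} pos (here refl) =
    subst (_≤ f x + ∑ xs f) (+-identityʳ (f x)) (+-monoʳ-≤ (f x) (∑-nonneg xs (pos ∘ there)))
  term≤∑ {xs = y ∷ xs} {f} {x} pos (there x∈) =
    subst (_≤ f y + ∑ xs f) (+-identityˡ (f x)) (+-mono-≤ (pos (here refl)) (term≤∑ (pos ∘ there) x∈))

  ∑-single : ∀ {xs : List A} {f x} → Unique xs → x ∈ xs →
             (∀ {y} → y ∈ xs → x ≢ y → f y ≡ 0ℤ) → ∑ xs f ≡ f x
  ∑-single {xs = x ∷ xs} {f} (x∉ ∷ u) (here refl) z = begin
    f x + ∑ xs f            ≡⟨ cong (λ s → f x + s) (∑-cong xs λ y∈ → z (there y∈) (All.lookup x∉ y∈)) ⟩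
    f x + ∑ xs (λ _ → 0ℤ)   ≡⟨ cong (λ s → f x + s) (∑-0 xs) ⟩
    f x + 0ℤ                ≡⟨ +-identityʳ (f x) ⟩
    f x                     ∎
  ∑-single {xs = y ∷ xs} {f} {x} (y∉ ∷ u) (there x∈) z = begin
    f y + ∑ xs f   ≡⟨ cong (_+ ∑ xs f) (z (here refl) (All.lookup y∉ x∈ ∘ sym)) ⟩
    0ℤ + ∑ xs f    ≡⟨ +-identityˡ _ ⟩
    ∑ xs f         ≡⟨ ∑-single u x∈ (z ∘ there) ⟩
    f x            ∎

-- Integer inequalities, indicators and the bound for one component.

module Integers where

  open import Data.Integer using (ℤ; +_; -[1+_]; 0ℤ; 1ℤ; _+_; _*_; _-_; _≤_; _<_; +≤+; +<+)
  open import Data.Integer.Properties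
  open import Data.Integer.Tactic.RingSolver using (solve-∀)
  open import Data.Empty using (⊥-elim)
  open import Data.Nat as ℕ using (zero; suc; z≤n; s≤s)
  open import Data.Product using (_×_; _,_)
  open import Data.Sum using (_⊎_; [_,_]′)
  open import Relation.Binary.PropositionalEquality
  open import Relation.Nullary using (¬_; Dec; yes; no)

  0≤n : ∀ {n} → 0ℤ ≤ + n
  0≤n = +≤+ z≤n

  0≤+ : ∀ {i j} → 0ℤ ≤ i → 0ℤ ≤ j → 0ℤ ≤ i + j
  0≤+ = +-mono-≤

  0≤* : ∀ {i j} → 0ℤ ≤ i → 0ℤ ≤ j → 0ℤ ≤ i * j
  0≤* {+ m} {+ n} _ _ = subst (0ℤ ≤_) (pos-* m n) 0≤n

  0≤square : ∀ i → 0ℤ ≤ i * i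
  0≤square (+ n)      = 0≤* {+ n} {+ n} 0≤n 0≤n
  0≤square (-[1+ n ]) = 0≤n

  -- Reduces an inequality to a ring identity: `s` is assembled from visibly nonnegative pieces, and
  -- `solve-∀` can check that it is the difference.
  ≤-by-slack : ∀ {i j} s → 0ℤ ≤ s → s ≡ j - i → i ≤ j
  ≤-by-slack s 0≤s refl = 0≤i-j⇒j≤i 0≤s

  ind : {P : Set} → Dec P → ℤ
  ind (yes _) = 1ℤ
  ind (no  _) = 0ℤ

  private variable
    P Q R : Set

  ind-yes : (d : Dec P) → P → ind d ≡ 1ℤ
  ind-yes (yes _) p = refl
  ind-yes (no ¬p) p = ⊥-elim (¬p p)

  ind-no : (d : Dec P) → ¬ P → ind d ≡ 0ℤ
  ind-no (yes p) ¬p = ⊥-elim (¬p p)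
  ind-no (no _)  ¬p = refl

  0≤ind : (d : Dec P) → 0ℤ ≤ ind d
  0≤ind (yes _) = 0≤n
  0≤ind (no _)  = 0≤n

  ind² : (d : Dec P) → ind d * ind d ≡ ind d
  ind² (yes _) = refl
  ind² (no _)  = refl

  ind-⊎ : (p : Dec P) (q : Dec Q) (r : Dec R) → (P → Q ⊎ R) → (Q → P) → (R → P) →
          (Q → ¬ R) → ind p ≡ ind q + ind r
  ind-⊎ p (yes b) (yes c) f g h d = ⊥-elim (d b c)
  ind-⊎ p (yes b) (no _)  f g h d = ind-yes p (g b)
  ind-⊎ p (no _)  (yes c) f g h d = ind-yes p (h c)
  ind-⊎ p (no ¬b) (no ¬c) f g h d = ind-no p λ a → [ ¬b , ¬c ]′ (f a)

  -- For a component with a vertices and e ordered adjacent pairs: its share of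
  -- 24 ∑ f - (fᵀAf + 6 |f|²), where f is constant equal to weight a on it, minus
  -- its share 3 (3a + 5) of 3 (3 (56 - |S|) + 5c).
  weight : ℤ → ℤ
  weight (+ 1) = + 2
  weight _     = + 1

  slack : ℤ → ℤ → ℤ
  slack a e = + 24 * (weight a * a) - (weight a * weight a * (e + + 6 * a) + + 9 * a + + 15)

  slack-bound : ∀ {a e} → 1ℤ ≤ a → a ≤ + 45 → e ≤ a * a - a → + 8 * e ≤ a * a + + 24 * a →
                0ℤ ≤ slack a e × (slack a e ≤ 0ℤ → a ≡ 1ℤ)
  slack-bound {+ 0} (+≤+ ())
  slack-bound {+ 1} {e} _ _ e≤ _ = subst (0ℤ ≤_) (eq e) (0≤* {+ 4} 0≤n (i≤j⇒0≤j-i e≤)) , λ _ → refl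
    where
    eq : ∀ e → + 4 * (0ℤ - e) ≡ + 24 * (+ 2 * + 1) - (+ 2 * + 2 * (e + + 6 * + 1) + + 9 * + 1 + + 15)
    eq = solve-∀
  slack-bound {+ (suc (suc m))} {e} _ a≤45 e≤ 8e≤ =
    <⇒≤ 0<slack , λ ≤0 → ⊥-elim (<⇒≱ 0<slack ≤0)
    where
    -- The slack with `weight` already evaluated to 1, so that the bounds can be stated for a
    -- variable `a`, on which `weight` does not reduce.
    unit-slack : ℤ → ℤ
    unit-slack a = + 24 * (+ 1 * a) - (+ 1 * + 1 * (e + + 6 * a) + + 9 * a + + 15)

    -- For 3 ≤ a ≤ 45, eight times the slack is at least (a - 3)(45 - a) + 15.
    large : ∀ a → + 3 ≤ a → a ≤ + 45 → + 8 * e ≤ a * a + + 24 * a → 0ℤ < unit-slack a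
    large a 3≤a a≤45 8e≤ = *-cancelˡ-<-nonNeg {0ℤ} (+ 8) (<-≤-trans (+<+ (s≤s z≤n)) 15≤)
      where
      eq : ∀ a e → (a * a + + 24 * a - + 8 * e) + (a - + 3) * (+ 45 - a) ≡
                   + 8 * (+ 24 * (+ 1 * a) - (+ 1 * + 1 * (e + + 6 * a) + + 9 * a + + 15)) - + 15
      eq = solve-∀
      15≤ : + 15 ≤ + 8 * unit-slack a
      15≤ = ≤-by-slack _ (0≤+ (i≤j⇒0≤j-i 8e≤) (0≤* (i≤j⇒0≤j-i 3≤a) (i≤j⇒0≤j-i a≤45))) (eq a e)

    two : ∀ e → + 2 - e ≡ + 24 * (+ 1 * + 2) - (+ 1 * + 1 * (e + + 6 * + 2) + + 9 * + 2 + + 15) - + 1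
    two = solve-∀

    split : ∀ m → + (2 ℕ.+ m) ≤ + 45 → e ≤ + (2 ℕ.+ m) * + (2 ℕ.+ m) - + (2 ℕ.+ m) →
            + 8 * e ≤ + (2 ℕ.+ m) * + (2 ℕ.+ m) + + 24 * + (2 ℕ.+ m) → 0ℤ < unit-slack (+ (2 ℕ.+ m))
    -- Here `a = 2`. The spectral bound would still allow `e = 6`, while the slack is `3 - e`; the
    -- trivial bound `e ≤ 2` is what makes it positive.
    split zero    _    e≤ _   = <-≤-trans (+<+ (s≤s z≤n)) (≤-by-slack _ (i≤j⇒0≤j-i e≤) (two e))
    split (suc m) a≤45 _  8e≤ = large _ (+≤+ (s≤s (s≤s (s≤s z≤n)))) a≤45 8e≤

    0<slack : 0ℤ < unit-slack (+ (2 ℕ.+ m))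
    0<slack = split m a≤45 e≤ 8e≤

-- Quadratic forms of integer matrices.

module Quadratic {A : Set} (V : List A) where

  open import Data.Integer using (ℤ; 0ℤ; 1ℤ; _+_; _*_; _-_; _≤_)
  open import Data.Integer.Properties
  open import Data.Integer.Tactic.RingSolver using (solve-∀)
  open import Data.List.Membership.Propositional using (_∈_)
  open import Data.List.Relation.Unary.Unique.Propositional using (Unique)
  open import Relation.Binary.PropositionalEquality
  open ≡-Reasoning
  open Sums
  open Integers

  quad : (A → A → ℤ) → (A → ℤ) → ℤ
  quad M f = ∑ V λ u → ∑ V λ v → M u v * (f u * f v)

  private variable
    I   : Set
    M N : A → A → ℤ
    f   : A → ℤ

  quad-cong : ∀ f → (∀ {u v} → u ∈ V → v ∈ V → M u v ≡ N u v) → quad M f ≡ quad N f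
  quad-cong f e = ∑-cong V λ u∈ → ∑-cong V λ v∈ → cong (_* _) (e u∈ v∈)

  -- Entrywise comparison carries over to the forms because the products `f u * f v` are
  -- nonnegative.
  quad-mono : (∀ v → 0ℤ ≤ f v) → (∀ u v → M u v ≤ N u v) → quad M f ≤ quad N f
  quad-mono {f = f} {M} {N} 0≤f le = ∑-mono V λ {u} _ → ∑-mono V λ {v} _ →
    ≤-by-slack _ (0≤* (i≤j⇒0≤j-i (le u v)) (0≤* (0≤f u) (0≤f v))) (eq (M u v) (N u v) (f u * f v))
    where
    eq : ∀ m n p → (n - m) * p ≡ n * p - m * p
    eq = solve-∀

  quad-+ : ∀ M N f → quad (λ u v → M u v + N u v) f ≡ quad M f + quad N f
  quad-+ M N f = begin
    quad (λ u v → M u v + N u v) f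
      ≡⟨ ∑-cong V (λ {u} _ → ∑-cong V λ {v} _ → *-distribʳ-+ (f u * f v) (M u v) (N u v)) ⟩
    ∑ V (λ u → ∑ V λ v → M u v * (f u * f v) + N u v * (f u * f v))
      ≡⟨ ∑-cong V (λ _ → ∑-+ V) ⟩
    ∑ V (λ u → ∑ V (λ v → M u v * (f u * f v)) + ∑ V (λ v → N u v * (f u * f v)))
      ≡⟨ ∑-+ V ⟩
    quad M f + quad N f ∎

  quad-* : ∀ k M f → quad (λ u v → k * M u v) f ≡ k * quad M f
  quad-* k M f = begin
    quad (λ u v → k * M u v) f
      ≡⟨ ∑-cong V (λ {u} _ → ∑-cong V λ {v} _ → *-assoc k (M u v) (f u * f v)) ⟩
    ∑ V (λ u → ∑ V λ v → k * (M u v * (f u * f v)))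
      ≡⟨ ∑-cong V (λ _ → ∑-*ˡ k V) ⟩
    ∑ V (λ u → k * ∑ V λ v → M u v * (f u * f v))
      ≡⟨ ∑-*ˡ k V ⟩
    k * quad M f ∎

  quad-∑ : ∀ f (is : List I) {N : I → A → A → ℤ} →
           quad (λ u v → ∑ is λ i → N i u v) f ≡ ∑ is (λ i → quad (N i) f)
  quad-∑ f is {N} = begin
    quad (λ u v → ∑ is λ i → N i u v) f
      ≡⟨ ∑-cong V (λ {u} _ → ∑-cong V λ {v} _ → ∑-*ʳ (f u * f v) is) ⟨
    ∑ V (λ u → ∑ V λ v → ∑ is λ i → N i u v * (f u * f v))
      ≡⟨ ∑-cong V (λ _ → ∑-swap V is) ⟩
    ∑ V (λ u → ∑ is λ i → ∑ V λ v → N i u v * (f u * f v))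
      ≡⟨ ∑-swap V is ⟩
    ∑ is (λ i → quad (N i) f) ∎

  quad-rank1 : ∀ f (p : A → ℤ) → quad (λ u v → p u * p v) f ≡ ∑ V (λ u → p u * f u) * ∑ V (λ u → p u * f u)
  quad-rank1 f p = begin
    quad (λ u v → p u * p v) f
      ≡⟨ ∑-cong V (λ {u} _ → ∑-cong V λ {v} _ → regroup (p u) (p v) (f u) (f v)) ⟩
    ∑ V (λ u → ∑ V λ v → p u * f u * (p v * f v))
      ≡⟨ ∑-* V V ⟨
    ∑ V (λ u → p u * f u) * ∑ V (λ u → p u * f u) ∎
    where
    regroup : ∀ a b c d → a * b * (c * d) ≡ a * c * (b * d)
    regroup = solve-∀

  quad-1 : ∀ f → quad (λ _ _ → 1ℤ) f ≡ ∑ V f * ∑ V f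
  quad-1 f = trans (quad-rank1 f (λ _ → 1ℤ)) (cong₂ _*_ e e)
    where
    e : ∑ V (λ u → 1ℤ * f u) ≡ ∑ V f
    e = ∑-cong V λ {u} _ → *-identityˡ (f u)

  -- A Gram matrix is a sum of rank-one matrices, and the form of each of these is a square.
  0≤quad-gram : ∀ f (is : List I) (p : I → A → ℤ) → 0ℤ ≤ quad (λ u v → ∑ is λ i → p i u * p i v) f
  0≤quad-gram f is p = subst (0ℤ ≤_) (sym (quad-∑ f is))
    (∑-nonneg is λ {i} _ →
      subst (0ℤ ≤_) (sym (quad-rank1 f (p i))) (0≤square (∑ V λ u → p i u * f u)))

  -- All cross terms vanish. It serves for indicators `x i` of distinct components, with `M` the
  -- adjacency or the identity matrix: no edge joins two components and no vertex lies in both.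
  quad-orthogonal : ∀ M {is : List I} → Unique is → (α : I → ℤ) (x : I → A → ℤ) →
    (∀ {i j} → i ≢ j → ∀ u v → M u v * (x i u * x j v) ≡ 0ℤ) →
    quad M (λ v → ∑ is λ i → α i * x i v) ≡ ∑ is (λ i → α i * α i * quad M (x i))
  quad-orthogonal M {is} is! α x orth = begin
    quad M (λ v → ∑ is λ i → α i * x i v)
      ≡⟨ ∑-cong V (λ {u} _ → ∑-cong V λ {v} _ → entry u v) ⟩
    quad-diagonal
      ≡⟨ ∑-cong V (λ _ → ∑-swap V is) ⟩
    ∑ V (λ u → ∑ is λ i → ∑ V λ v → α i * α i * (M u v * (x i u * x i v)))
      ≡⟨ ∑-swap V is ⟩
    ∑ is (λ i → ∑ V λ u → ∑ V λ v → α i * α i * (M u v * (x i u * x i v)))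
      ≡⟨ ∑-cong is (λ {i} _ → trans (∑-cong V (λ _ → ∑-*ˡ (α i * α i) V)) (∑-*ˡ (α i * α i) V)) ⟩
    ∑ is (λ i → α i * α i * quad M (x i)) ∎
    where
    quad-diagonal : ℤ
    quad-diagonal = ∑ V λ u → ∑ V λ v → ∑ is λ i → α i * α i * (M u v * (x i u * x i v))

    regroup : ∀ m a b y z → m * (a * y * (b * z)) ≡ a * b * (m * (y * z))
    regroup = solve-∀

    entry : ∀ u v → M u v * (∑ is (λ i → α i * x i u) * ∑ is (λ j → α j * x j v)) ≡
                    ∑ is (λ i → α i * α i * (M u v * (x i u * x i v)))
    entry u v = begin
      M u v * (∑ is (λ i → α i * x i u) * ∑ is (λ j → α j * x j v))
        ≡⟨ cong (M u v *_) (∑-* is is) ⟩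
      M u v * ∑ is (λ i → ∑ is λ j → α i * x i u * (α j * x j v))
        ≡⟨ ∑-*ˡ (M u v) is ⟨
      ∑ is (λ i → M u v * ∑ is λ j → α i * x i u * (α j * x j v))
        ≡⟨ ∑-cong is (λ _ → ∑-*ˡ (M u v) is) ⟨
      ∑ is (λ i → ∑ is λ j → M u v * (α i * x i u * (α j * x j v)))
        ≡⟨ ∑-cong is (λ {i} _ → ∑-cong is λ {j} _ → regroup (M u v) (α i) (α j) (x i u) (x j v)) ⟩
      ∑ is (λ i → ∑ is λ j → α i * α j * (M u v * (x i u * x j v)))
        ≡⟨ ∑-cong is (λ {i} i∈ → ∑-single is! i∈ λ {j} _ i≢j →
             trans (cong (α i * α j *_) (orth i≢j u v)) (*-zeroʳ (α i * α j))) ⟩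
      ∑ is (λ i → α i * α i * (M u v * (x i u * x i v))) ∎

-- Enumeration of the subsets of a given size.

module Layers where

  open import Data.Fin.Subset using (Subset; ∣_∣; ⊥; inside; outside)
  open import Data.List using (List; []; _∷_; map; _++_)
  open import Data.List.Membership.Propositional using (_∈_)
  open import Data.List.Membership.Propositional.Properties using (∈-map⁺; ∈-map⁻; ∈-++⁺ˡ; ∈-++⁺ʳ)
  open import Data.List.Relation.Unary.All as All using (All; []; _∷_)
  import Data.List.Relation.Unary.All.Properties as All
  open import Data.List.Relation.Unary.AllPairs using ([]; _∷_)
  open import Data.List.Relation.Unary.Any using (here)
  open import Data.List.Relation.Unary.Unique.Propositional using (Unique)
  import Data.List.Relation.Unary.Unique.Propositional.Properties as Unique
  open import Data.Nat using (ℕ; zero; suc)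
  open import Data.Product using (_,_)
  open import Data.Vec using ([]; _∷_)
  open import Data.Vec.Properties using (∷-injectiveʳ)
  open import Relation.Binary.PropositionalEquality using (_≡_; refl; cong)
  open import Relation.Nullary using (¬_)

  ∣p∣≡0⇒p≡⊥ : ∀ {n} (p : Subset n) → ∣ p ∣ ≡ 0 → p ≡ ⊥
  ∣p∣≡0⇒p≡⊥ []            _ = refl
  ∣p∣≡0⇒p≡⊥ (outside ∷ p) e = cong (outside ∷_) (∣p∣≡0⇒p≡⊥ p e)

  -- Pascal's recursion: the sets containing the first point come before those avoiding it.
  layer : ∀ n → ℕ → List (Subset n)
  layer zero    zero    = [] ∷ []
  layer zero    (suc k) = []
  layer (suc n) zero    = map (outside ∷_) (layer n zero)
  layer (suc n) (suc k) = map (inside ∷_) (layer n k) ++ map (outside ∷_) (layer n (suc k))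

  ∈-layer : ∀ {n} (p : Subset n) → p ∈ layer n ∣ p ∣
  ∈-layer []            = here refl
  ∈-layer (inside  ∷ p) = ∈-++⁺ˡ (∈-map⁺ (inside ∷_) (∈-layer p))
  ∈-layer (outside ∷ p) with ∣ p ∣ | ∈-layer p
  ... | zero  | p∈ = ∈-map⁺ (outside ∷_) p∈
  ... | suc k | p∈ = ∈-++⁺ʳ _ (∈-map⁺ (outside ∷_) p∈)

  layer-size : ∀ n k → All (λ p → ∣ p ∣ ≡ k) (layer n k)
  layer-size zero    zero    = refl ∷ []
  layer-size zero    (suc k) = []
  layer-size (suc n) zero    = All.map⁺ (layer-size n zero)
  layer-size (suc n) (suc k) =
    All.++⁺ (All.map⁺ (All.map (cong suc) (layer-size n k))) (All.map⁺ (layer-size n (suc k)))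

  layer-unique : ∀ n k → Unique (layer n k)
  layer-unique zero    zero    = [] ∷ []
  layer-unique zero    (suc k) = []
  layer-unique (suc n) zero    = Unique.map⁺ ∷-injectiveʳ (layer-unique n zero)
  layer-unique (suc n) (suc k) =
    Unique.++⁺ (Unique.map⁺ ∷-injectiveʳ (layer-unique n k))
               (Unique.map⁺ ∷-injectiveʳ (layer-unique n (suc k)))
               λ { (p∈ , q∈) → different p∈ q∈ }
    where
    different : ∀ {p} → p ∈ map (inside ∷_) (layer n k) → ¬ p ∈ map (outside ∷_) (layer n (suc k))
    different p∈ q∈ with ∈-map⁻ _ p∈ | ∈-map⁻ _ q∈
    ... | _ , _ , refl | _ , _ , ()

-- Eigenvalue bounds for the Kneser graph in the Johnson scheme.

module Spectrum where

  open import Data.Empty using (⊥-elim)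
  open import Data.Fin.Subset using (Subset; ∣_∣; _∩_)
  open import Data.Fin.Subset.Properties using (∩-comm; ∩-idem; ∣⊥∣≡0)
  open import Data.Integer using (ℤ; +_; -_; 0ℤ; 1ℤ; _+_; _*_; _-_; _≤_; Positive)
  open import Data.Integer.Properties
  open import Data.Integer.Tactic.RingSolver using (solve-∀)
  open import Data.List using ([]; _∷_; map)
  open import Data.List.Membership.Propositional using (_∈_)
  open import Data.List.Relation.Unary.All as All using (All; all?)
  import Data.List.Relation.Unary.All.Properties as All
  open import Data.List.Relation.Unary.Unique.Propositional using (Unique)
  open import Data.Nat as ℕ using (ℕ; suc)
  open import Data.Product using (_×_; _,_)
  open import Data.Vec.Properties using (≡-dec)
  import Data.Bool.Properties as Bool
  open import Relation.Binary.Definitions using (DecidableEquality)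
  open import Relation.Binary.PropositionalEquality
  open import Relation.Nullary using (¬_; Dec)
  open import Relation.Nullary.Decidable using (from-yes; _→-dec_)
  open Kneser 8 3 using (IsVertex; Adj)
  open Sums
  open Integers
  open Layers

  Vertex : Set
  Vertex = Subset 8

  infix 4 _≟ᵛ_
  _≟ᵛ_ : DecidableEquality Vertex
  _≟ᵛ_ = ≡-dec Bool._≟_

  meet : Vertex → Vertex → ℕ
  meet u v = ∣ u ∩ v ∣

  -- Adjacency and equality of 3-subsets depend only on the size of the intersection, so both
  -- matrices belong to the Johnson scheme J(8,3), and their entries evaluate to numerals.
  disjoint same : ℕ → ℤ
  disjoint 0 = 1ℤ
  disjoint _ = 0ℤ
  same 3 = 1ℤ
  same _ = 0ℤ

  adj eq : Vertex → Vertex → ℤ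
  adj u v = disjoint (meet u v)
  eq  u v = same (meet u v)

  0≤adj : ∀ u v → 0ℤ ≤ adj u v
  0≤adj u v with meet u v
  ... | 0     = 0≤n
  ... | suc _ = 0≤n

  -- Intersection sizes 0 and 3 exclude each other.
  adj+eq≤1 : ∀ u v → adj u v + eq u v ≤ 1ℤ
  adj+eq≤1 u v with meet u v
  ... | 0                       = ≤-refl
  ... | 1                       = 0≤n
  ... | 2                       = 0≤n
  ... | 3                       = ≤-refl
  ... | suc (suc (suc (suc _))) = 0≤n

  Adj-sym : ∀ {u v} → Adj u v → Adj v u
  Adj-sym {u} {v} = trans (∩-comm v u)

  Adj⇒adj≡1 : ∀ {u v} → Adj u v → adj u v ≡ 1ℤ
  Adj⇒adj≡1 e = cong disjoint (trans (cong ∣_∣ e) (∣⊥∣≡0 8))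

  ¬Adj⇒adj≡0 : ∀ {u v} → ¬ Adj u v → adj u v ≡ 0ℤ
  ¬Adj⇒adj≡0 {u} {v} ¬e with meet u v in t
  ... | 0     = ⊥-elim (¬e (∣p∣≡0⇒p≡⊥ _ t))
  ... | suc _ = refl

  -- A matrix of the Johnson scheme, given by its entries at intersection sizes 0, 1, 2 and 3; the
  -- last clause stands for size 3.
  kernel : ℤ → ℤ → ℤ → ℤ → ℕ → ℤ
  kernel a b c d 0 = a
  kernel a b c d 1 = b
  kernel a b c d 2 = c
  kernel a b c d _ = d

  dot : (ℕ → ℤ) → List ℕ → List ℕ → ℤ
  dot φ (m ∷ ms) (n ∷ ns) = φ m * φ n + dot φ ms ns
  dot φ _        _        = 0ℤ

  dot-map : ∀ φ (ws : List Vertex) {g h} →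
            dot φ (map g ws) (map h ws) ≡ ∑ ws (λ w → φ (g w) * φ (h w))
  dot-map φ []       = refl
  dot-map φ (w ∷ ws) = cong (λ s → φ _ * φ _ + s) (dot-map φ ws)

  -- A vertex together with a list of its intersection sizes, so that evaluating the Gram table can
  -- share these sizes among the entries of a row.
  Row : Set
  Row = Vertex × List ℕ

  -- Encodes a combination of `A`, `I` and `J` and a scale factor. By linearity `combination`
  -- applies both to the entries of these matrices and to their quadratic forms.
  record Coefficients : Set where
    constructor coefficients
    field scale adj-coeff eq-coeff one-coeff : ℤ

    combination : ℤ → ℤ → ℤ → ℤ
    combination p q r = adj-coeff * p + eq-coeff * q + one-coeff * r

  open Coefficients

  Gram : List (ℕ → ℤ) → Coefficients → Row → Row → Set
  Gram Φ κ (u , ms) (v , ns) =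
    ∑ Φ (λ φ → dot φ ms ns) ≡ scale κ * combination κ (adj u v) (eq u v) 1ℤ

  GramTable : List (ℕ → ℤ) → Coefficients → List Row → Set
  GramTable Φ κ rs = All (λ r → All (Gram Φ κ r) rs) rs

  gramTable? : ∀ Φ κ rs → Dec (GramTable Φ κ rs)
  gramTable? Φ κ rs = all? (λ (u , ms) → all? (λ (v , ns) → _ ≟ _) rs) rs

  -- A has eigenvalues 10, -6, 3, -1 on the four Johnson eigenspaces. There
  -- 7A + 42I - 2J is 7 (0, 0, 9, 5) = 7 ((0, 0, 3, -1)² + (0, 0, 0, 2)²) and
  -- 8 (24I - 8A + J) is (0, -24, 0, 16)². The kernels give the entries of these
  -- square roots (the first two scaled by 70) by intersection size.
  Φ₁ Φ₂ : List (ℕ → ℤ)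
  Φ₁ = kernel (+ 26) (- + 16) (+ 12) (+ 40) ∷ kernel (- + 7) (+ 7) (- + 14) (+ 70) ∷ []
  Φ₂ = kernel (+ 1) (+ 1) (- + 3) (+ 5) ∷ []

  κ₁ κ₂ : Coefficients
  κ₁ = coefficients (+ 700) (+ 7) (+ 42) (- + 2)
  κ₂ = coefficients (+ 8) (- + 8) (+ 24) (+ 1)

  -- Opacity keeps later goals from unfolding the list of 56 vertices; whatever needs the list
  -- itself is proved in an `opaque` block.
  opaque

    V : List Vertex
    V = layer 8 3

    ∈V : ∀ {v} → IsVertex v → v ∈ V
    ∈V {v} e = subst (λ k → v ∈ layer 8 k) e (∈-layer v)

    V-vertices : All IsVertex V
    V-vertices = layer-size 8 3

    V-unique : Unique V
    V-unique = layer-unique 8 3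

    ∑V1 : ∑ V (λ _ → 1ℤ) ≡ + 56
    ∑V1 = refl

    -- The vertex `w` and its neighbours, the ten 3-subsets of the five remaining points.
    degree+1 : ∀ {w} → w ∈ V → ∑ V (λ v → adj w v + eq w v) ≡ + 11
    degree+1 = All.lookup (from-yes (all? (λ w → ∑ V (λ v → adj w v + eq w v) ≟ + 11) V))

    meet≡3⇒≡ : ∀ {u v} → u ∈ V → v ∈ V → meet u v ≡ 3 → u ≡ v
    meet≡3⇒≡ u∈ v∈ = All.lookup (All.lookup table u∈) v∈
      where
      table : All (λ u → All (λ v → meet u v ≡ 3 → u ≡ v) V) V
      table = from-yes (all? (λ u → all? (λ v → (meet u v ℕ.≟ 3) →-dec (u ≟ᵛ v)) V) V)

  row : Vertex → Row
  row v = v , map (meet v) V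

  opaque
    unfolding V

    gram₁ : GramTable Φ₁ κ₁ (map row V)
    gram₁ = from-yes (gramTable? Φ₁ κ₁ (map row V))

    gram₂ : GramTable Φ₂ κ₂ (map row V)
    gram₂ = from-yes (gramTable? Φ₂ κ₂ (map row V))

  open Quadratic V

  eq-refl : ∀ {v} → v ∈ V → eq v v ≡ 1ℤ
  eq-refl {v} v∈ = cong same (trans (cong ∣_∣ (∩-idem v)) (All.lookup V-vertices v∈))

  ≢⇒eq≡0 : ∀ {u v} → u ∈ V → v ∈ V → u ≢ v → eq u v ≡ 0ℤ
  ≢⇒eq≡0 {u} {v} u∈ v∈ u≢v with meet u v in t
  ... | 0                       = refl
  ... | 1                       = refl
  ... | 2                       = refl
  ... | 3                       = ⊥-elim (u≢v (meet≡3⇒≡ u∈ v∈ t))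
  ... | suc (suc (suc (suc _))) = refl

  quad-eq : ∀ f → quad eq f ≡ ∑ V (λ v → f v * f v)
  quad-eq f = ∑-cong V λ {u} u∈ → trans
    (∑-single V-unique u∈ λ {v} v∈ u≢v → cong (_* (f u * f v)) (≢⇒eq≡0 u∈ v∈ u≢v))
    (trans (cong (_* (f u * f u)) (eq-refl u∈)) (*-identityˡ (f u * f u)))

  -- The table exhibits `scale κ` times the matrix as a sum of Gram matrices, one for each kernel,
  -- so its form is nonnegative; the positive scale is cancelled.
  gram-inequality : ∀ Φ κ .{{_ : Positive (scale κ)}} → GramTable Φ κ (map row V) → ∀ f →
                    0ℤ ≤ combination κ (quad adj f) (quad eq f) (∑ V f * ∑ V f)
  gram-inequality Φ κ@(coefficients k a b c) table f =
    *-cancelˡ-≤-pos 0ℤ _ k (subst₂ _≤_ (sym (*-zeroʳ k)) expand gram≥0)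
    where
    open ≡-Reasoning
    G : (ℕ → ℤ) → Vertex → Vertex → ℤ
    G φ u v = ∑ V λ w → φ (meet u w) * φ (meet v w)

    gram≥0 : 0ℤ ≤ quad (λ u v → ∑ Φ λ φ → G φ u v) f
    gram≥0 = subst (0ℤ ≤_) (sym (quad-∑ f Φ))
      (∑-nonneg Φ λ {φ} _ → 0≤quad-gram f V (λ w u → φ (meet u w)))

    M : Vertex → Vertex → ℤ
    M u v = a * adj u v + b * eq u v + c * 1ℤ

    entry : ∀ {u v} → u ∈ V → v ∈ V → ∑ Φ (λ φ → G φ u v) ≡ k * M u v
    entry {u} {v} u∈ v∈ = trans (∑-cong Φ λ {φ} _ → sym (dot-map φ V))
      (All.lookup (All.map⁻ (All.lookup (All.map⁻ table) u∈)) v∈)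

    expand : quad (λ u v → ∑ Φ λ φ → G φ u v) f ≡
             k * combination κ (quad adj f) (quad eq f) (∑ V f * ∑ V f)
    expand = begin
      quad (λ u v → ∑ Φ λ φ → G φ u v) f
        ≡⟨ quad-cong f entry ⟩
      quad (λ u v → k * M u v) f
        ≡⟨ quad-* k M f ⟩
      k * quad M f
        ≡⟨ cong (k *_) (quad-+ (λ u v → a * adj u v + b * eq u v) (λ _ _ → c * 1ℤ) f) ⟩
      k * (quad (λ u v → a * adj u v + b * eq u v) f + quad (λ _ _ → c * 1ℤ) f)
        ≡⟨ cong (k *_) (cong₂ _+_ (quad-+ (λ u v → a * adj u v) (λ u v → b * eq u v) f)
                                  (quad-* c (λ _ _ → 1ℤ) f)) ⟩
      k * (quad (λ u v → a * adj u v) f + quad (λ u v → b * eq u v) f + c * quad (λ _ _ → 1ℤ) f)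
        ≡⟨ cong (k *_) (cong₂ _+_ (cong₂ _+_ (quad-* a adj f) (quad-* b eq f)) (cong (c *_) (quad-1 f))) ⟩
      k * combination κ (quad adj f) (quad eq f) (∑ V f * ∑ V f) ∎

  -- As -6 is the least eigenvalue of `A`, `A + 6I` is positive semidefinite. On constants it has
  -- eigenvalue 16 and `J` has 56, so 16/56 = 2/7 of `J` can be subtracted.
  2∑²≤7adj+42eq : ∀ f → + 2 * (∑ V f * ∑ V f) ≤ + 7 * quad adj f + + 42 * quad eq f
  2∑²≤7adj+42eq f = ≤-by-slack _ (gram-inequality Φ₁ κ₁ gram₁ f) (regroup (quad adj f) (quad eq f) (∑ V f * ∑ V f))
    where
    regroup : ∀ p q r → + 7 * p + + 42 * q + (- + 2) * r ≡ + 7 * p + + 42 * q - + 2 * r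
    regroup = solve-∀

  -- Apart from the constants the eigenvalues of `A` are at most 3. On constants `3I - A` has
  -- eigenvalue -7, which 7/56 = 1/8 of `J` compensates.
  8adj≤24eq+∑² : ∀ f → + 8 * quad adj f ≤ + 24 * quad eq f + ∑ V f * ∑ V f
  8adj≤24eq+∑² f = ≤-by-slack _ (gram-inequality Φ₂ κ₂ gram₂ f) (regroup (quad adj f) (quad eq f) (∑ V f * ∑ V f))
    where
    regroup : ∀ p q r → (- + 8) * p + + 24 * q + + 1 * r ≡ + 24 * q + r - + 8 * p
    regroup = solve-∀

-- The Hoffman bound for independent sets.

module Independence where

  open import Data.Integer using (ℤ; +_; 0ℤ; 1ℤ; _+_; _*_; _≤_)
  open import Data.Integer.Properties
  open import Data.Integer.Tactic.RingSolver using (solve-∀)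
  open import Data.List using ([]; _∷_; length)
  open import Data.List.Membership.DecPropositional Spectrum._≟ᵛ_ public using (_∈?_)
  open import Data.List.Relation.Unary.All as All using (All; []; _∷_)
  open import Data.List.Relation.Unary.AllPairs using ([]; _∷_)
  open import Data.List.Relation.Unary.Any using (here; there)
  open import Data.List.Relation.Unary.Unique.Propositional using (Unique)
  open import Data.Nat as ℕ using (zero; suc; z≤n)
  open import Data.Sum using (inj₁; inj₂)
  open import Function using (_∘_)
  open import Relation.Binary.PropositionalEquality
  open import Relation.Nullary using (yes; no)
  open Kneser 8 3
  open Sums
  open Integers
  open Spectrum
  open Quadratic V

  -- Lets the size of a vertex set, a list length, enter sums over `V`; without repetitions each
  -- entry counts once.
  ∑-members : ∀ {xs} → Unique xs → All IsVertex xs → ∑ V (λ v → ind (v ∈? xs)) ≡ + length xs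
  ∑-members {[]}     _         _          =
    trans (∑-cong V (λ {v} _ → ind-no (v ∈? []) λ ())) (∑-0 V)
  ∑-members {x ∷ xs} (x∉ ∷ u) (px ∷ pxs) = begin
    ∑ V (λ v → ind (v ∈? (x ∷ xs)))
      ≡⟨ ∑-cong V (λ {v} _ → ind-⊎ (v ∈? (x ∷ xs)) (v ≟ᵛ x) (v ∈? xs)
           (λ { (here e) → inj₁ e ; (there v∈) → inj₂ v∈ }) here there
           (λ { refl v∈ → All.lookup x∉ v∈ refl })) ⟩
    ∑ V (λ v → ind (v ≟ᵛ x) + ind (v ∈? xs))
      ≡⟨ ∑-+ V ⟩
    ∑ V (λ v → ind (v ≟ᵛ x)) + ∑ V (λ v → ind (v ∈? xs))
      ≡⟨ cong₂ _+_ (∑-single V-unique (∈V px) λ {v} _ x≢v → ind-no (v ≟ᵛ x) (x≢v ∘ sym)) (∑-members u pxs) ⟩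
    ind (x ≟ᵛ x) + + length xs
      ≡⟨ cong (_+ + length xs) (ind-yes (x ≟ᵛ x) refl) ⟩
    + suc (length xs) ∎
    where open ≡-Reasoning

  -- For the indicator of an independent set of size n the adjacency form vanishes, and the Hoffman
  -- inequality reads 2n² ≤ 42n.
  independent⇒size≤21 : ∀ J → IsIndependent J → size J ℕ.≤ 21
  independent⇒size≤21 J indep = bound (size J) 2n²≤42n
    where
    f : Vertex → ℤ
    f v = ind (v ∈? elems J)

    no-edge : ∀ u v → adj u v * (f u * f v) ≡ 0ℤ
    no-edge u v with u ∈? elems J | v ∈? elems J
    ... | yes u∈ | yes v∈ = cong (_* 1ℤ) (¬Adj⇒adj≡0 (indep u∈ v∈))
    ... | yes _  | no _   = *-zeroʳ (adj u v)
    ... | no _   | _      = *-zeroʳ (adj u v)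

    ∑f : ∑ V f ≡ + size J
    ∑f = ∑-members (unique J) (vertices J)

    quad-adj : quad adj f ≡ 0ℤ
    quad-adj = trans (∑-cong V λ {u} _ → trans (∑-cong V λ {v} _ → no-edge u v) (∑-0 V)) (∑-0 V)

    quad-eq-f : quad eq f ≡ + size J
    quad-eq-f = trans (quad-eq f) (trans (∑-cong V λ {v} _ → ind² (v ∈? elems J)) ∑f)

    2n²≤42n : + 2 * (+ size J * + size J) ≤ + 42 * + size J
    2n²≤42n = ≤-trans (subst (λ t → + 2 * (t * t) ≤ + 7 * quad adj f + + 42 * quad eq f) ∑f (2∑²≤7adj+42eq f))
      (≤-reflexive (trans (cong₂ (λ p q → + 7 * p + + 42 * q) quad-adj quad-eq-f) (+-identityˡ _)))

    bound : ∀ n → + 2 * (+ n * + n) ≤ + 42 * + n → n ℕ.≤ 21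
    bound zero    _  = z≤n
    bound (suc n) le = drop‿+≤+ (*-cancelˡ-≤-pos (+ suc n) (+ 21) (+ suc n)
      (*-cancelˡ-≤-pos _ _ (+ 2) (subst (+ 2 * (+ suc n * + suc n) ≤_) (regroup (+ suc n)) le)))
      where
      regroup : ∀ n → + 42 * n ≡ + 2 * (n * + 21)
      regroup = solve-∀

-- The components left by a vertex cut.

module Components (S : Kneser.VertexSet 8 3) (c : ℕ)
  (isCut : Kneser.IsVertexCut 8 3 S) (comps : Kneser.NumComponents 8 3 S c) where

  open import Data.Empty using (⊥-elim)
  open import Data.Fin using (Fin)
  import Data.Fin.Properties as Fin
  open import Data.Fin.Subset using (∣_∣)
  open import Data.Integer using (ℤ; +_; -_; 0ℤ; 1ℤ; _+_; _*_; _-_; _≤_; +≤+)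
  open import Data.Integer.Properties
  open import Data.Integer.Tactic.RingSolver using (solve-∀)
  open import Data.List using ([]; _∷_; length; allFin; filter)
  open import Data.List.Properties using (length-tabulate)
  open import Data.List.Membership.Propositional using (_∈_; _∉_)
  open import Data.List.Membership.Propositional.Properties using (∈-allFin; ∈-filter⁺; ∈-filter⁻)
  open import Data.List.Relation.Unary.All as All using (All)
  import Data.List.Relation.Unary.All.Properties as All
  open import Data.List.Relation.Unary.Unique.Propositional using (Unique)
  import Data.List.Relation.Unary.Unique.Propositional.Properties as Unique
  open import Data.Nat as ℕ using ()
  import Data.Nat.Properties as ℕ
  open import Data.Product using (∃-syntax; _×_; _,_; proj₁; proj₂)
  open import Function using (_∘_; mk⇔)
  open import Relation.Binary.PropositionalEquality
  open import Relation.Nullary using (¬_; Dec; yes; no; ¬?)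
  open Kneser 8 3
  open Sums
  open Integers
  open Spectrum
  open Quadratic V
  open Independence

  rep : Fin c → Vertex
  rep = proj₁ comps

  rep-alive : ∀ i → Alive S (rep i)
  rep-alive = proj₁ (proj₂ comps)

  rep-separated : ∀ {i j} → Reach S (rep i) (rep j) → i ≡ j
  rep-separated = proj₁ (proj₂ (proj₂ comps)) _ _

  target-alive : ∀ {u v} → Reach S u v → Alive S v
  target-alive (here a)     = a
  target-alive (step _ _ ρ) = target-alive ρ

  reach-trans : ∀ {u v w} → Reach S u v → Reach S v w → Reach S u w
  reach-trans (here _)     σ = σ
  reach-trans (step a e ρ) σ = step a e (reach-trans ρ σ)

  reach-snoc : ∀ {u v w} → Reach S u v → Adj v w → Alive S w → Reach S u w
  reach-snoc ρ e a = reach-trans ρ (step (target-alive ρ) e (here a))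

  reach-sym : ∀ {u v} → Reach S u v → Reach S v u
  reach-sym (here a)             = here a
  reach-sym (step {u} {v} a e ρ) = reach-snoc (reach-sym ρ) (Adj-sym {u} {v} e) a

  Block : Fin c → Vertex → Set
  Block i v = Reach S (rep i) v

  block-unique : ∀ {i j v} → Block i v → Block j v → i ≡ j
  block-unique ρ σ = rep-separated (reach-trans ρ (reach-sym σ))

  block? : ∀ i v → Dec (Block i v)
  block? i v with ∣ v ∣ ℕ.≟ 3 | v ∈? elems S
  ... | no ∣v∣≢3  | _       = no λ ρ → ∣v∣≢3 (proj₁ (target-alive ρ))
  ... | yes _     | yes v∈S = no λ ρ → proj₂ (target-alive ρ) v∈S
  ... | yes ∣v∣≡3 | no v∉S  with proj₂ (proj₂ (proj₂ comps)) v (∣v∣≡3 , v∉S)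
  ... | j , ρ with i Fin.≟ j
  ... | yes refl = yes ρ
  ... | no i≢j   = no λ σ → i≢j (block-unique σ ρ)

  block-vertex : ∀ {i v} → Block i v → v ∈ V
  block-vertex = ∈V ∘ proj₁ ∘ target-alive

  -- The indicator of component `i`; then `a i` counts its vertices and `e i` its ordered adjacent
  -- pairs.
  x : Fin c → Vertex → ℤ
  x i v = ind (block? i v)

  a e : Fin c → ℤ
  a i = ∑ V (x i)
  e i = quad adj (x i)

  quad-eq-x : ∀ i → quad eq (x i) ≡ a i
  quad-eq-x i = trans (quad-eq (x i)) (∑-cong V λ {v} _ → ind² (block? i v))

  -- The entries of `A + I` are at most 1, so its form at the indicator is at most that of `J`.
  e≤a²-a : ∀ i → e i ≤ a i * a i - a i
  e≤a²-a i = ≤-by-slack _ (i≤j⇒0≤j-i e+a≤a²) (regroup (e i) (a i))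
    where
    regroup : ∀ e a → a * a - (e + a) ≡ a * a - a - e
    regroup = solve-∀
    e+a≤a² : e i + a i ≤ a i * a i
    e+a≤a² = subst₂ _≤_ (trans (quad-+ adj eq (x i)) (cong (λ t → e i + t) (quad-eq-x i))) (quad-1 (x i))
      (quad-mono (λ v → 0≤ind (block? i v)) adj+eq≤1)

  8e≤a²+24a : ∀ i → + 8 * e i ≤ a i * a i + + 24 * a i
  8e≤a²+24a i = subst (+ 8 * e i ≤_) (+-comm (+ 24 * a i) (a i * a i))
    (subst (λ t → + 8 * e i ≤ + 24 * t + a i * a i) (quad-eq-x i) (8adj≤24eq+∑² (x i)))

  1≤a : ∀ i → 1ℤ ≤ a i
  1≤a i = subst (_≤ a i) (ind-yes (block? i (rep i)) (here (rep-alive i)))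
    (term≤∑ (λ {v} _ → 0≤ind (block? i v)) (∈V (proj₁ (rep-alive i))))

  -- The two separated vertices of the cut cannot both lie in block `i`.
  outside : ∀ i → ∃[ w ] (Alive S w × ¬ Block i w)
  outside i = pick isCut
    where
    pick : IsVertexCut S → ∃[ w ] (Alive S w × ¬ Block i w)
    pick (u , v , u-alive , v-alive , apart) with block? i u
    ... | no ¬ρ = u , u-alive , ¬ρ
    ... | yes ρ = v , v-alive , λ σ → apart (reach-trans (reach-sym ρ) σ)

  a≤45 : ∀ i → a i ≤ + 45
  a≤45 i with outside i
  ... | w , w-alive , ¬ρ = ≤-by-slack _ (i≤j⇒0≤j-i a+11≤56) (regroup (a i))
    where
    w∈ : w ∈ V
    w∈ = ∈V (proj₁ w-alive)

    regroup : ∀ a → + 56 - (a + + 11) ≡ + 45 - a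
    regroup = solve-∀

    -- A neighbour of `w` inside block `i` would bring `w` into it. Hence the block misses `w` and
    -- all its neighbours, eleven vertices in all.
    disjoint-terms : ∀ v → x i v + (adj w v + eq w v) ≤ 1ℤ
    disjoint-terms v with block? i v
    ... | no _  = subst (_≤ 1ℤ) (sym (+-identityˡ _)) (adj+eq≤1 w v)
    ... | yes σ = ≤-reflexive (cong (λ t → 1ℤ + t) (cong₂ _+_
      (¬Adj⇒adj≡0 λ wv → ¬ρ (reach-snoc σ (Adj-sym {w} {v} wv) w-alive))
      (≢⇒eq≡0 w∈ (block-vertex σ) λ { refl → ¬ρ σ })))

    a+11≤56 : a i + + 11 ≤ + 56
    a+11≤56 = subst₂ _≤_ (trans (∑-+ V) (cong (λ t → a i + t) (degree+1 w∈))) ∑V1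
      (∑-mono V λ {v} _ → disjoint-terms v)

  slack-bounds : ∀ i → 0ℤ ≤ slack (a i) (e i) × (slack (a i) (e i) ≤ 0ℤ → a i ≡ 1ℤ)
  slack-bounds i = slack-bound (1≤a i) (a≤45 i) (e≤a²-a i) (8e≤a²+24a i)

  -- Splitting the Hoffman inequality over the components.

  is : List (Fin c)
  is = allFin c

  is-unique : Unique is
  is-unique = Unique.allFin⁺ c

  covered : ∀ {v} → v ∈ V → ∑ is (λ i → x i v) + ind (v ∈? elems S) ≡ 1ℤ
  covered {v} v∈ = cases (v ∈? elems S)
    where
    cases : (d : Dec (v ∈ elems S)) → ∑ is (λ i → x i v) + ind d ≡ 1ℤ
    cases (yes v∈S) = cong (_+ 1ℤ) (trans
      (∑-cong is λ {i} _ → ind-no (block? i v) λ ρ → proj₂ (target-alive ρ) v∈S) (∑-0 is))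
    cases (no v∉S) with proj₂ (proj₂ (proj₂ comps)) v (All.lookup V-vertices v∈ , v∉S)
    ... | j , ρ = cong (_+ 0ℤ) (trans
      (∑-single is-unique (∈-allFin j) λ {i} _ j≢i → ind-no (block? i v) (j≢i ∘ block-unique ρ))
      (ind-yes (block? j v) ρ))

  ∑a+size : ∑ is a + + size S ≡ + 56
  ∑a+size = begin
    ∑ is a + + size S
      ≡⟨ cong₂ _+_ (∑-swap V is) (∑-members (unique S) (vertices S)) ⟨
    ∑ V (λ v → ∑ is λ i → x i v) + ∑ V (λ v → ind (v ∈? elems S))
      ≡⟨ ∑-+ V ⟨
    ∑ V (λ v → ∑ is (λ i → x i v) + ind (v ∈? elems S))
      ≡⟨ ∑-cong V covered ⟩
    ∑ V (λ _ → 1ℤ)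
      ≡⟨ ∑V1 ⟩
    + 56 ∎
    where open ≡-Reasoning

  ∑is1 : ∑ is (λ _ → 1ℤ) ≡ + c
  ∑is1 = trans (count is) (cong +_ (length-tabulate {n = c} (λ i → i)))
    where
    count : (js : List (Fin c)) → ∑ js (λ _ → 1ℤ) ≡ + length js
    count []       = refl
    count (_ ∷ js) = cong (λ t → 1ℤ + t) (count js)

  α : Fin c → ℤ
  α i = weight (a i)

  f : Vertex → ℤ
  f v = ∑ is λ i → α i * x i v

  ∑f : ∑ V f ≡ ∑ is (λ i → α i * a i)
  ∑f = trans (∑-swap V is) (∑-cong is λ {i} _ → ∑-*ˡ (α i) V)

  -- An edge between two blocks would merge them.
  adj-orthogonal : ∀ {i j} → i ≢ j → ∀ u v → adj u v * (x i u * x j v) ≡ 0ℤ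
  adj-orthogonal {i} {j} i≢j u v with block? i u | block? j v
  ... | no _  | _     = *-zeroʳ (adj u v)
  ... | yes _ | no _  = *-zeroʳ (adj u v)
  ... | yes ρ | yes σ = cong (_* 1ℤ)
    (¬Adj⇒adj≡0 λ uv → i≢j (block-unique (reach-snoc ρ uv (target-alive σ)) σ))

  eq-orthogonal : ∀ {i j} → i ≢ j → ∀ u v → eq u v * (x i u * x j v) ≡ 0ℤ
  eq-orthogonal {i} {j} i≢j u v with block? i u | block? j v
  ... | no _  | _     = *-zeroʳ (eq u v)
  ... | yes _ | no _  = *-zeroʳ (eq u v)
  ... | yes ρ | yes σ = cong (_* 1ℤ)
    (≢⇒eq≡0 (block-vertex ρ) (block-vertex σ) λ { refl → i≢j (block-unique ρ σ) })

  -- The values of `fᵀAf`, `|f|²` and `∑ f`, written as sums over the components.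
  qa qe s : ℤ
  qa = ∑ is λ i → α i * α i * e i
  qe = ∑ is λ i → α i * α i * a i
  s  = ∑ is λ i → α i * a i

  quad-adj-f : quad adj f ≡ qa
  quad-adj-f = quad-orthogonal adj is-unique α x adj-orthogonal

  quad-eq-f : quad eq f ≡ qe
  quad-eq-f = trans (quad-orthogonal eq is-unique α x eq-orthogonal)
    (∑-cong is λ {i} _ → cong (α i * α i *_) (quad-eq-x i))

  total-slack : ℤ
  total-slack = ∑ is λ i → slack (a i) (e i)

  total-slack-≡ : total-slack ≡ + 24 * s - (qa + + 6 * qe + + 9 * ∑ is a + + 15 * + c)
  total-slack-≡ = begin
    total-slack
      ≡⟨ ∑-cong is (λ {i} _ → separate (α i) (a i) (e i)) ⟩
    ∑ is (λ i → + 24 * (α i * a i) + ((- + 1) * (α i * α i * e i) + ((- + 6) * (α i * α i * a i) +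
      ((- + 9) * a i + (- + 15) * 1ℤ))))
      ≡⟨ ∑-+ is ⟩
    _ ≡⟨ cong₂ _+_ (∑-*ˡ (+ 24) is) (∑-+ is) ⟩
    _ ≡⟨ cong (λ t → + 24 * s + t) (cong₂ _+_ (∑-*ˡ (- + 1) is) (∑-+ is)) ⟩
    _ ≡⟨ cong (λ t → + 24 * s + ((- + 1) * qa + t)) (cong₂ _+_ (∑-*ˡ (- + 6) is) (∑-+ is)) ⟩
    _ ≡⟨ cong (λ t → + 24 * s + ((- + 1) * qa + ((- + 6) * qe + t)))
           (cong₂ _+_ (∑-*ˡ (- + 9) is) (trans (∑-*ˡ (- + 15) is) (cong ((- + 15) *_) ∑is1))) ⟩
    + 24 * s + ((- + 1) * qa + ((- + 6) * qe + ((- + 9) * ∑ is a + (- + 15) * + c)))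
      ≡⟨ collect s qa qe (∑ is a) (+ c) ⟩
    + 24 * s - (qa + + 6 * qe + + 9 * ∑ is a + + 15 * + c) ∎
    where
    open ≡-Reasoning
    -- The coefficients `0ℤ - + n` evaluate to the negative literals of the chain above.
    separate : ∀ α a e → + 24 * (α * a) - (α * α * (e + + 6 * a) + + 9 * a + + 15) ≡
      + 24 * (α * a) + ((0ℤ - + 1) * (α * α * e) + ((0ℤ - + 6) * (α * α * a) +
        ((0ℤ - + 9) * a + (0ℤ - + 15) * 1ℤ)))
    separate = solve-∀
    collect : ∀ s p q A c →
      + 24 * s + ((0ℤ - + 1) * p + ((0ℤ - + 6) * q + ((0ℤ - + 9) * A + (0ℤ - + 15) * c))) ≡
      + 24 * s - (p + + 6 * q + + 9 * A + + 15 * c)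
    collect = solve-∀

  -- The tangent point 42 is the value of s for the complement of a star.
  total-slack≤ : + 15 * + c + total-slack ≤ + 9 * + size S
  total-slack≤ = *-cancelˡ-≤-pos _ _ (+ 7) (≤-by-slack _
    -- Adding twice the square cancels `2 s²` and leaves an expression linear in `s`.
    (0≤+ (i≤j⇒0≤j-i gram) (0≤* {+ 2} 0≤n (0≤square (s - + 42))))
    (combine s qa qe (∑ is a) (+ c) (+ size S) total-slack ∑a+size total-slack-≡))
    where
    gram : + 2 * (s * s) ≤ + 7 * qa + + 42 * qe
    gram = subst₂ _≤_ (cong (λ t → + 2 * (t * t)) ∑f)
      (cong₂ (λ p q → + 7 * p + + 42 * q) quad-adj-f quad-eq-f) (2∑²≤7adj+42eq f)

    combine : ∀ s p q A c k d → A + k ≡ + 56 → d ≡ + 24 * s - (p + + 6 * q + + 9 * A + + 15 * c) →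
      + 7 * p + + 42 * q - + 2 * (s * s) + + 2 * ((s - + 42) * (s - + 42)) ≡
      + 7 * (+ 9 * k) - + 7 * (+ 15 * c + d)
    combine s p q A c k d A+k≡56 d≡ = begin
      + 7 * p + + 42 * q - + 2 * (s * s) + + 2 * ((s - + 42) * (s - + 42))
        ≡⟨ arith s p q A c k ⟩
      -- The constant 2 · 42² equals 63 · 56, so a multiple of the vertex count absorbs it; the
      -- added term is zero.
      rhs (+ 24 * s - (p + + 6 * q + + 9 * A + + 15 * c)) + + 63 * (+ 56 - (A + k))
        ≡⟨ cong₂ (λ t u → rhs t + + 63 * (+ 56 - u)) (sym d≡) A+k≡56 ⟩
      rhs d + 0ℤ
        ≡⟨ +-identityʳ (rhs d) ⟩
      rhs d ∎
      where
      open ≡-Reasoning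
      rhs : ℤ → ℤ
      rhs t = + 7 * (+ 9 * k) - + 7 * (+ 15 * c + t)
      arith : ∀ s p q A c k →
        + 7 * p + + 42 * q - + 2 * (s * s) + + 2 * ((s - + 42) * (s - + 42)) ≡
        + 7 * (+ 9 * k) - + 7 * (+ 15 * c + (+ 24 * s - (p + + 6 * q + + 9 * A + + 15 * c))) +
          + 63 * (+ 56 - (A + k))
      arith = solve-∀

  15c≤9size : + 15 * + c ≤ + 9 * + size S
  15c≤9size = ≤-trans (≤-by-slack total-slack (∑-nonneg is λ {i} _ → proj₁ (slack-bounds i))
    (regroup (+ 15 * + c) total-slack)) total-slack≤
    where
    regroup : ∀ m t → t ≡ m + t - m
    regroup = solve-∀

  toughness-bound : 5 ℕ.* c ℕ.≤ 3 ℕ.* size S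
  toughness-bound = drop‿+≤+ (subst₂ _≤_ (sym (pos-* 5 c)) (sym (pos-* 3 (size S)))
    (*-cancelˡ-≤-pos _ _ (+ 3) (subst₂ _≤_ (fifteen (+ c)) (nine (+ size S)) 15c≤9size)))
    where
    fifteen : ∀ n → + 15 * n ≡ + 3 * (+ 5 * n)
    fifteen = solve-∀
    nine : ∀ n → + 9 * n ≡ + 3 * (+ 3 * n)
    nine = solve-∀

  -- The complement of the cut and the case of equality.

  survivors : VertexSet
  survivors = record
    { elems    = filter (λ v → ¬? (v ∈? elems S)) V
    ; vertices = All.filter⁺ (λ v → ¬? (v ∈? elems S)) V-vertices
    ; unique   = Unique.filter⁺ (λ v → ¬? (v ∈? elems S)) V-unique
    }

  survivor⇒∉ : ∀ {v} → v ∈ elems survivors → v ∉ elems S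
  survivor⇒∉ v∈ = proj₂ (∈-filter⁻ (λ v → ¬? (v ∈? elems S)) {xs = V} v∈)

  ∉⇒survivor : ∀ {v} → v ∈ V → v ∉ elems S → v ∈ elems survivors
  ∉⇒survivor = ∈-filter⁺ (λ v → ¬? (v ∈? elems S))

  complement : IsComplementOf S survivors
  complement v v-vertex = mk⇔ (λ v∈S v∈I → survivor⇒∉ v∈I v∈S) back
    where
    back : v ∉ elems survivors → v ∈ elems S
    back v∉I with v ∈? elems S
    ... | yes v∈S = v∈S
    ... | no  v∉S = ⊥-elim (v∉I (∉⇒survivor (∈V v-vertex) v∉S))

  survivors+size : size survivors ℕ.+ size S ≡ 56
  survivors+size = +-injective (begin
    + size survivors + + size S
      ≡⟨ cong₂ _+_ (∑-members (unique survivors) (vertices survivors)) (∑-members (unique S) (vertices S)) ⟨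
    ∑ V (λ v → ind (v ∈? elems survivors)) + ∑ V (λ v → ind (v ∈? elems S))
      ≡⟨ ∑-+ V ⟨
    ∑ V (λ v → ind (v ∈? elems survivors) + ind (v ∈? elems S))
      ≡⟨ ∑-cong V exactly-one ⟩
    ∑ V (λ _ → 1ℤ)
      ≡⟨ ∑V1 ⟩
    + 56 ∎)
    where
    open ≡-Reasoning
    exactly-one : ∀ {v} → v ∈ V → ind (v ∈? elems survivors) + ind (v ∈? elems S) ≡ 1ℤ
    exactly-one {v} v∈ = cases (v ∈? elems S)
      where
      cases : (d : Dec (v ∈ elems S)) → ind (v ∈? elems survivors) + ind d ≡ 1ℤ
      cases (yes v∈S) = cong (_+ 1ℤ) (ind-no (v ∈? elems survivors) λ v∈I → survivor⇒∉ v∈I v∈S)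
      cases (no v∉S)  = cong (_+ 0ℤ) (ind-yes (v ∈? elems survivors) (∉⇒survivor v∈ v∉S))

  module _ (tight : 3 ℕ.* size S ≡ 5 ℕ.* c) where

    -- Equality means 9|S| = 15c, which leaves no room in `total-slack≤`.
    total-slack≤0 : total-slack ≤ 0ℤ
    total-slack≤0 = ≤-by-slack _ (i≤j⇒0≤j-i total-slack≤) (begin
      + 9 * + size S - (+ 15 * + c + total-slack)
        ≡⟨ thrice (+ size S) (+ c) total-slack ⟩
      + 3 * (+ 3 * + size S - + 5 * + c) + (0ℤ - total-slack)
        ≡⟨ cong (λ t → + 3 * (t - + 5 * + c) + (0ℤ - total-slack)) 3size≡5c ⟩
      + 3 * (+ 5 * + c - + 5 * + c) + (0ℤ - total-slack)
        ≡⟨ cancel (+ c) total-slack ⟩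
      0ℤ - total-slack ∎)
      where
      open ≡-Reasoning
      3size≡5c : + 3 * + size S ≡ + 5 * + c
      3size≡5c = trans (sym (pos-* 3 (size S))) (trans (cong +_ tight) (pos-* 5 c))
      thrice : ∀ k c t → + 9 * k - (+ 15 * c + t) ≡ + 3 * (+ 3 * k - + 5 * c) + (0ℤ - t)
      thrice = solve-∀
      cancel : ∀ c t → + 3 * (+ 5 * c - + 5 * c) + (0ℤ - t) ≡ 0ℤ - t
      cancel = solve-∀

    -- The slacks are nonnegative with total at most 0, so each is at most 0, which `slack-bound`
    -- allows only for singletons.
    a≡1 : ∀ i → a i ≡ 1ℤ
    a≡1 i = proj₂ (slack-bounds i)
      (≤-trans (term≤∑ (λ {j} _ → proj₁ (slack-bounds j)) (∈-allFin i)) total-slack≤0)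

    -- Two adjacent survivors share a component and contribute 1 to its `e i`, but a singleton has
    -- `e i ≤ 0`.
    survivors-independent : IsIndependent survivors
    survivors-independent {u} {v} u∈ v∈ uv
      with proj₂ (proj₂ (proj₂ comps)) u (All.lookup (vertices survivors) u∈ , survivor⇒∉ u∈)
    ... | i , ρ = 1≰0 (≤-trans 1≤e e≤0)
      where
      1≰0 : ¬ 1ℤ ≤ 0ℤ
      1≰0 (+≤+ ())

      σ : Block i v
      σ = reach-snoc ρ uv (All.lookup (vertices survivors) v∈ , survivor⇒∉ v∈)

      e≤0 : e i ≤ 0ℤ
      e≤0 = subst (λ t → e i ≤ t * t - t) (a≡1 i) (e≤a²-a i)

      entry : Vertex → Vertex → ℤ
      entry u v = adj u v * (x i u * x i v)

      0≤entry : ∀ u v → 0ℤ ≤ entry u v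
      0≤entry u v = 0≤* (0≤adj u v) (0≤* (0≤ind (block? i u)) (0≤ind (block? i v)))

      1≤e : 1ℤ ≤ e i
      1≤e = subst (_≤ e i)
        (cong₂ _*_ (Adj⇒adj≡1 uv) (cong₂ _*_ (ind-yes (block? i u) ρ) (ind-yes (block? i v) σ)))
        (≤-trans (term≤∑ {f = entry u} (λ {w} _ → 0≤entry u w) (block-vertex σ))
                 (term≤∑ {f = λ u → ∑ V (entry u)} (λ {w} _ → ∑-nonneg V λ {z} _ → 0≤entry w z) (block-vertex ρ)))

    c+size : c ℕ.+ size S ≡ 56
    c+size = +-injective (trans
      (cong (_+ + size S) (sym (trans (∑-cong is λ {i} _ → a≡1 i) ∑is1))) ∑a+size)

    c≡21 : c ≡ 21
    c≡21 = ℕ.*-cancelˡ-≡ c 21 8 (begin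
      8 ℕ.* c               ≡⟨ ℕ.*-distribʳ-+ c 3 5 ⟩
      3 ℕ.* c ℕ.+ 5 ℕ.* c      ≡⟨ cong (3 ℕ.* c ℕ.+_) tight ⟨
      3 ℕ.* c ℕ.+ 3 ℕ.* size S ≡⟨ ℕ.*-distribˡ-+ 3 c (size S) ⟨
      3 ℕ.* (c ℕ.+ size S)   ≡⟨ cong (3 ℕ.*_) c+size ⟩
      168 ∎)
      where open ≡-Reasoning

    size-survivors : size survivors ≡ 21
    size-survivors = trans (ℕ.+-cancelʳ-≡ (size S) _ _ (trans survivors+size (sym c+size))) c≡21

    survivors-maximum : IsMaxIndependent survivors
    survivors-maximum = survivors-independent ,
      λ J indep → ℕ.≤-trans (independent⇒size≤21 J indep) (ℕ.≤-reflexive (sym size-survivors))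

-- The complement of a star attains the ratio.

module Star where

  open import Data.Fin using (Fin; zero; suc)
  open import Data.Fin.Subset using (Subset; inside; outside)
  open import Data.Empty using (⊥-elim)
  open import Data.List using (map; length; lookup)
  open import Data.List.Membership.Propositional using (_∈_)
  open import Data.List.Membership.Propositional.Properties using (∈-map⁺; ∈-map⁻; ∈-lookup)
  open import Data.List.Relation.Unary.All as All using (All)
  import Data.List.Relation.Unary.All.Properties as All
  open import Data.List.Relation.Unary.Any using (index)
  open import Data.List.Relation.Unary.Any.Properties using (lookup-index)
  open import Data.List.Relation.Unary.AllPairs using (_∷_)
  open import Data.List.Relation.Unary.Unique.Propositional using (Unique)
  import Data.List.Relation.Unary.Unique.Propositional.Properties as Unique
  open import Data.Nat using (suc)
  import Data.Nat.Properties as ℕ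
  open import Data.Product using (∃-syntax; _×_; _,_)
  open import Data.Vec using (_∷_)
  open import Data.Vec.Properties using (∷-injectiveʳ)
  open import Relation.Binary.PropositionalEquality
  open import Relation.Nullary using (¬_)
  open Kneser 8 3
  open Layers

  lookup-injective : ∀ {A : Set} {xs : List A} → Unique xs →
                     ∀ i j → lookup xs i ≡ lookup xs j → i ≡ j
  lookup-injective (x∉ ∷ u) zero    zero    _  = refl
  lookup-injective (x∉ ∷ u) zero    (suc j) x≡ = ⊥-elim (All.lookup x∉ (∈-lookup j) x≡)
  lookup-injective (x∉ ∷ u) (suc i) zero    ≡x = ⊥-elim (All.lookup x∉ (∈-lookup i) (sym ≡x))
  lookup-injective (x∉ ∷ u) (suc i) (suc j) e  = cong suc (lookup-injective u i j e)

  -- The 35 vertices avoiding the first point. The survivors form the star at that point: 21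
  -- pairwise intersecting sets, hence 21 isolated vertices, and 35/21 = 5/3.
  co-star : VertexSet
  co-star = record
    { elems    = map (outside ∷_) (layer 7 3)
    ; vertices = All.map⁺ {f = outside ∷_} (layer-size 7 3)
    ; unique   = Unique.map⁺ {f = outside ∷_} ∷-injectiveʳ (layer-unique 7 3)
    }

  c : ℕ
  c = length (layer 7 2)

  ray : Fin c → Subset 8
  ray i = inside ∷ lookup (layer 7 2) i

  ray-alive : ∀ i → Alive co-star (ray i)
  ray-alive i = cong suc (All.lookup (layer-size 7 2) (∈-lookup {xs = layer 7 2} i)) , avoids
    where
    avoids : ¬ ray i ∈ elems co-star
    avoids r∈ with ∈-map⁻ (outside ∷_) r∈
    ... | _ , _ , ()

  alive⇒ray : ∀ v → Alive co-star v → ∃[ i ] ray i ≡ v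
  alive⇒ray (inside  ∷ p) (e , _)   = index p∈ , cong (inside ∷_) (sym (lookup-index p∈))
    where
    p∈ : p ∈ layer 7 2
    p∈ = subst (λ k → p ∈ layer 7 k) (ℕ.suc-injective e) (∈-layer p)
  alive⇒ray (outside ∷ p) (e , v∉) =
    ⊥-elim (v∉ (∈-map⁺ (outside ∷_) (subst (λ k → p ∈ layer 7 k) e (∈-layer p))))

  source-alive : ∀ {u v} → Reach co-star u v → Alive co-star u
  source-alive (here a)     = a
  source-alive (step a _ _) = a

  -- Survivors share the first point, so no two are adjacent and a path cannot take a step.
  reach⇒≡ : ∀ {u v} → Reach co-star u v → u ≡ v
  reach⇒≡ (here _) = refl
  reach⇒≡ (step {u} {v} a uv ρ) with alive⇒ray u a | alive⇒ray v (source-alive ρ)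
  ... | i , refl | j , refl with uv
  ... | ()

  ray-separated : ∀ i j → Reach co-star (ray i) (ray j) → i ≡ j
  ray-separated i j ρ = lookup-injective (layer-unique 7 2) i j (∷-injectiveʳ (reach⇒≡ ρ))

  components : NumComponents co-star c
  components = ray , ray-alive , ray-separated , λ v v-alive → reach (alive⇒ray v v-alive) v-alive
    where
    reach : ∀ {v} → ∃[ i ] ray i ≡ v → Alive co-star v → ∃[ i ] Reach co-star (ray i) v
    reach (i , refl) a = i , here a

  cut : IsVertexCut co-star
  cut = ray zero , ray (suc zero) , ray-alive zero , ray-alive (suc zero) , apart
    where
    apart : ¬ Reach co-star (ray zero) (ray (suc zero))
    apart ρ with ray-separated zero (suc zero) ρ
    ... | ()

-- The bound, its attainment and the extremal cuts together.

open import Data.Nat using (_*_; _≤_)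
open import Data.Product using (∃-syntax; _×_; _,_)
open import Relation.Binary.PropositionalEquality using (_≡_; refl)
open Kneser 8 3

theorem21 : ((S : VertexSet) (c : ℕ) → IsVertexCut S → NumComponents S c → 5 * c ≤ 3 * size S)
    × (∃[ S ] ∃[ c ] (IsVertexCut S × NumComponents S c × 3 * size S ≡ 5 * c))
    × ((S : VertexSet) (c : ℕ) → IsVertexCut S → NumComponents S c → 3 * size S ≡ 5 * c
    → ∃[ I ] (IsMaxIndependent I × IsComplementOf S I))
theorem21 =
  (λ S c isCut comps → Components.toughness-bound S c isCut comps) ,
  -- Here `refl` evaluates 3 · 35 = 105 = 5 · 21.
  (Star.co-star , Star.c , Star.cut , Star.components , refl) ,
  λ S c isCut comps tight → let open Components S c isCut comps in
    survivors , survivors-maximum tight , complement
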